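{- Let $r,s\ge 1$ and $t\ge 2$ be integers. The expectation of the size $|\mathrm{core}_t(\lambda)|$ of the $t$-core of a uniformly random partition $\lambda\in\mathcal{P}_{r,s}$ equals $$\frac{rs}{(r+s)(r+s-1)}\left(\binom{(r+s)\bmod t}{2}+\left\lfloor\frac{r+s}{t}\right\rfloor\binom{t}{2}\right).$$
   Context: A partition $\lambda=(\lambda_1\ge\lambda_2\ge\cdots)$ is a weakly decreasing finite sequence of positive integers (possibly empty); $\ell(\lambda)$ is its number of parts and $|\lambda|=\sum_j\lambda_j$ its size. $\mathcal{P}_{r,s}$ is the (finite) set of partitions with $\ell(\lambda)\le r$ and $\lambda_1\le s$ (with $\lambda_1=0$ for the empty partition). A rim-hook of $\lambda$ is a connected skew shape $\lambda/\mu$ (with $\mu\subseteq\lambda$ a partition) containing no $2\times2$ block of boxes; a $t$-rim hook is one with exactly $t$ boxes. The $t$-core $\mathrm{core}_t(\lambda)$ is the partition obtained by successively removing $t$-rim hooks until none can be removed (it does not depend on the order of removals). Here $(r+s)\bmod t$ denotes the remainder in $\{0,1,\dots,t-1\}$, and $\binom{0}{2}=\binom{1}{2}=0$. -}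

module Defs where

open import Data.Nat using (ℕ; zero; suc; _+_; _*_; _∸_; _≤_; _<_; _≥_; z≤n; s≤s; NonZero; ∣_-_∣; >-nonZero⁻¹)
open import Data.Nat.Properties
open import Data.Nat.Induction using (<-wellFounded)
open import Induction.WellFounded using (Acc; acc)
open import Data.Integer using (+_)
open import Data.Rational using (ℚ) renaming (_/_ to _/ℚ_)
open import Data.Nat.ListAction using (sum)
open import Data.List using (List; []; _∷_; length; map; concat; upTo; cartesianProduct)
open import Data.List.Properties using (∷-injectiveˡ; ∷-injectiveʳ)
open import Data.List.Membership.Propositional using (_∈_; lose; find)
open import Data.List.Membership.Propositional.Properties using (∈-concat⁺′; ∈-concat⁻′; ∈-map⁺; ∈-map⁻; ∈-upTo⁺; ∈-upTo⁻; ∈-cartesianProduct⁺)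
open import Data.List.Relation.Binary.Disjoint.Propositional using (Disjoint)
open import Data.List.Relation.Unary.All as All using (All; []; _∷_)
import Data.List.Relation.Unary.All.Properties as All
open import Data.List.Relation.Unary.AllPairs as AllPairs using (AllPairs; []; _∷_)
import Data.List.Relation.Unary.AllPairs.Properties as AllPairs
open import Data.List.Relation.Unary.Any as Any using (here; there)
open import Data.List.Relation.Unary.Linked as Linked using (Linked; []; [-]; _∷_)
open import Data.List.Relation.Unary.Unique.Propositional using (Unique)
import Data.List.Relation.Unary.Unique.Propositional.Properties as Unique
open import Data.Product using (∃-syntax; _×_; _,_; proj₁; proj₂)
open import Data.Product.Properties using (≡-dec)
open import Data.Sum using (_⊎_; inj₁; inj₂)
open import Function using (_∘_)
open import Function.Bundles using (_⇔_; mk⇔)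
open import Relation.Binary.Construct.Closure.ReflexiveTransitive using (Star; ε; _◅_; _◅◅_)
open import Relation.Binary.PropositionalEquality using (_≡_; refl; sym; subst)
open import Relation.Nullary using (¬_; Dec; yes; no; contradiction)
open import Relation.Nullary.Decidable using (map′; _×-dec_; _⊎-dec_; _→-dec_; ¬?)

------------------------------------------------------------------------
-- Partitions

record IsPartition (λs : List ℕ) : Set where
  constructor isPartition
  field
    decreasing : Linked _≥_ λs
    positive   : All (0 <_) λs

-- Rows are indexed from 0, so that `row λs 0` is the largest part λ₁
-- (and is 0 when λs is empty).
row : List ℕ → ℕ → ℕ
row []       _       = 0
row (p ∷ _)  zero    = p
row (_ ∷ λs) (suc i) = row λs i

record InRectangle (r s : ℕ) (λs : List ℕ) : Set where
  constructor inRectangle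
  field
    partition : IsPartition λs
    length≤   : length λs ≤ r
    largest≤  : row λs 0 ≤ s

-- The list of all partitions in 𝒫_{r,s}: either empty, or a first part
-- k ∈ {1,…,s} followed by a partition in 𝒫_{r-1,k}.  `∈𝒫⇔` and `𝒫-unique`
-- show that every element of 𝒫_{r,s} is listed exactly once.
𝒫 : ℕ → ℕ → List (List ℕ)
𝒫 zero    s = [] ∷ []
𝒫 (suc r) s = [] ∷ concat (map (λ k → map (suc k ∷_) (𝒫 r (suc k))) (upTo s))

------------------------------------------------------------------------
-- Rim hooks

-- (i , j) is the box in row i and column j, both counted from 0.
Box : Set
Box = ℕ × ℕ

_∈[_/_] : Box → List ℕ → List ℕ → Set
(i , j) ∈[ λs / μs ] = row μs i ≤ j × j < row λs i

Adjacent : Box → Box → Set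
Adjacent (i , j) (k , l) = ∣ i - k ∣ + ∣ j - l ∣ ≡ 1

Step : List ℕ → List ℕ → Box → Box → Set
Step λs μs x y = x ∈[ λs / μs ] × y ∈[ λs / μs ] × Adjacent x y

Connected : List ℕ → List ℕ → Set
Connected λs μs =
  ∀ x y → x ∈[ λs / μs ] → y ∈[ λs / μs ] → Star (Step λs μs) x y

No2×2 : List ℕ → List ℕ → Set
No2×2 λs μs = ∀ i j → ¬ ((i     , j) ∈[ λs / μs ] × (i     , suc j) ∈[ λs / μs ] ×
                         (suc i , j) ∈[ λs / μs ] × (suc i , suc j) ∈[ λs / μs ])

_⊆_ : List ℕ → List ℕ → Set
μs ⊆ λs = ∀ i → row μs i ≤ row λs i

-- μs is obtained from λs by removing a t-rim hook.  As μs ⊆ λs, the skew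
-- shape λs/μs has sum λs − sum μs boxes.
record RemoveRimHook (t : ℕ) (λs μs : List ℕ) : Set where
  constructor removeRimHook
  field
    partition : IsPartition μs
    contained : μs ⊆ λs
    connected : Connected λs μs
    no2×2     : No2×2 λs μs
    boxes     : sum λs ≡ sum μs + t

IsCoreOf : (t : ℕ) (λs κs : List ℕ) → Set
IsCoreOf t λs κs = Star (RemoveRimHook t) λs κs × ¬ (∃[ μs ] RemoveRimHook t κs μs)

------------------------------------------------------------------------
-- Correctness of the enumeration 𝒫

private
  head≥ : ∀ {p λs} → Linked _≥_ (p ∷ λs) → row λs 0 ≤ p
  head≥ [-]      = z≤n
  head≥ (p≥ ∷ _) = p≥

  _∷≥_ : ∀ {p λs} → row λs 0 ≤ p → Linked _≥_ λs → Linked _≥_ (p ∷ λs)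
  _∷≥_ {λs = []}    _ _ = [-]
  _∷≥_ {λs = _ ∷ _} h l = h ∷ l

  ∈𝒫⁺ : ∀ r s {λs} → InRectangle r s λs → λs ∈ 𝒫 r s
  ∈𝒫⁺ zero    s {[]} _ = here refl
  ∈𝒫⁺ (suc r) s {[]} _ = here refl
  ∈𝒫⁺ zero s {_ ∷ _} (inRectangle _ () _)
  ∈𝒫⁺ (suc r) s {zero ∷ _} (inRectangle (isPartition _ (() ∷ _)) _ _)
  ∈𝒫⁺ (suc r) s {suc k ∷ λs} (inRectangle (isPartition d (_ ∷ ps)) (s≤s l≤) k<s) =
    there (∈-concat⁺′
      (∈-map⁺ (suc k ∷_)
        (∈𝒫⁺ r (suc k) (inRectangle (isPartition (Linked.tail d) ps) l≤ (head≥ d))))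
      (∈-map⁺ (λ k → map (suc k ∷_) (𝒫 r (suc k))) (∈-upTo⁺ k<s)))

  ∈𝒫⁻ : ∀ r s {λs} → λs ∈ 𝒫 r s → InRectangle r s λs
  ∈𝒫⁻ zero    s (here refl) = inRectangle (isPartition [] []) z≤n z≤n
  ∈𝒫⁻ (suc r) s (here refl) = inRectangle (isPartition [] []) z≤n z≤n
  ∈𝒫⁻ (suc r) s (there m)
    with _ , m₁ , m₂ ← ∈-concat⁻′ (map (λ k → map (suc k ∷_) (𝒫 r (suc k))) (upTo s)) m
    with k , k∈ , refl ← ∈-map⁻ (λ k → map (suc k ∷_) (𝒫 r (suc k))) m₂
    with _ , m₃ , refl ← ∈-map⁻ (suc k ∷_) m₁
    with inRectangle (isPartition d ps) l≤ h ← ∈𝒫⁻ r (suc k) m₃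
    = inRectangle (isPartition (h ∷≥ d) (s≤s z≤n ∷ ps)) (s≤s l≤) (∈-upTo⁻ k∈)

∈𝒫⇔ : ∀ r s {λs} → (λs ∈ 𝒫 r s) ⇔ InRectangle r s λs
∈𝒫⇔ r s = mk⇔ (∈𝒫⁻ r s) (∈𝒫⁺ r s)

𝒫-unique : ∀ r s → Unique (𝒫 r s)
𝒫-unique zero    s = [] ∷ []
𝒫-unique (suc r) s = All.tabulate []≢ ∷ Unique.concat⁺
  (All.map⁺ (All.tabulate λ {k} _ → Unique.map⁺ ∷-injectiveʳ (𝒫-unique r (suc k))))
  (AllPairs.map⁺ (AllPairs.map disjoint (Unique.upTo⁺ s)))
  where
  block : ℕ → List (List ℕ)
  block k = map (suc k ∷_) (𝒫 r (suc k))

  []≢ : ∀ {xs} → xs ∈ concat (map block (upTo s)) → ¬ ([] ≡ xs)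
  []≢ m refl
    with _ , m₁ , m₂ ← ∈-concat⁻′ (map block (upTo s)) m
    with k , _ , refl ← ∈-map⁻ block m₂
    with _ , _ , () ← ∈-map⁻ (suc k ∷_) m₁

  disjoint : ∀ {k l} → ¬ (k ≡ l) → Disjoint (block k) (block l)
  disjoint {k} {l} k≢l (m , n)
    with _ , _ , refl ← ∈-map⁻ (suc k ∷_) m
    with _ , _ , e ← ∈-map⁻ (suc l ∷_) n
    = k≢l (suc-injective (∷-injectiveˡ e))

𝒫-nonEmpty : ∀ r s → NonZero (length (𝒫 r s))
𝒫-nonEmpty zero    s = _
𝒫-nonEmpty (suc r) s = _

------------------------------------------------------------------------
-- Existence of the t-core, by a finite search for removable rim hooks

-- Reachability in a finite graph is decidable: `Via zs x y` says that there
-- is a walk from x to y whose intermediate vertices all lie in zs.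
module Reachability {A : Set} {E : A → A → Set} (_≟ᴬ_ : (x y : A) → Dec (x ≡ y)) (E? : (x y : A) → Dec (E x y)) where

  Via : List A → A → A → Set
  Via []       x y = x ≡ y ⊎ E x y
  Via (z ∷ zs) x y = Via zs x y ⊎ (Via zs x z × Via zs z y)

  via? : ∀ zs x y → Dec (Via zs x y)
  via? []       x y = (x ≟ᴬ y) ⊎-dec E? x y
  via? (z ∷ zs) x y = via? zs x y ⊎-dec (via? zs x z ×-dec via? zs z y)

  sound : ∀ zs {x y} → Via zs x y → Star E x y
  sound []       (inj₁ refl)    = ε
  sound []       (inj₂ e)       = e ◅ ε
  sound (z ∷ zs) (inj₁ p)       = sound zs p
  sound (z ∷ zs) (inj₂ (p , q)) = sound zs p ◅◅ sound zs q

  via-refl : ∀ zs {x} → Via zs x x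
  via-refl []       = inj₁ refl
  via-refl (_ ∷ zs) = inj₁ (via-refl zs)

  via-edge : ∀ zs {x y} → E x y → Via zs x y
  via-edge []       e = inj₂ e
  via-edge (_ ∷ zs) e = inj₁ (via-edge zs e)

  join : ∀ {zs v x y} → v ∈ zs → Via zs x v → Via zs v y → Via zs x y
  join (here refl) p q = inj₂ (to p , from q)
    where
    to : ∀ {z zs x} → Via (z ∷ zs) x z → Via zs x z
    to (inj₁ p)       = p
    to (inj₂ (p , _)) = p
    from : ∀ {z zs y} → Via (z ∷ zs) z y → Via zs z y
    from (inj₁ q)       = q
    from (inj₂ (_ , q)) = q
  join (there m) (inj₁ p)       (inj₁ q)       = inj₁ (join m p q)
  join (there m) (inj₁ p)       (inj₂ (q , w)) = inj₂ (join m p q , w)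
  join (there m) (inj₂ (w , p)) (inj₁ q)       = inj₂ (w , join m p q)
  join (there m) (inj₂ (w , _)) (inj₂ (_ , w′)) = inj₂ (w , w′)

  complete : ∀ {zs} → (∀ {x y} → E x y → y ∈ zs) → ∀ {x y} → Star E x y → Via zs x y
  complete {zs} _ ε        = via-refl zs
  complete {zs} c (e ◅ es) = join (c e) (via-edge zs e) (complete c es)

  star? : ∀ zs → (∀ {x y} → E x y → y ∈ zs) → ∀ x y → Dec (Star E x y)
  star? zs c x y = map′ (sound zs) (complete c) (via? zs x y)

private
  row>0⇒< : ∀ λs {i j} → j < row λs i → i < length λs
  row>0⇒< (_ ∷ _)  {zero}  _ = s≤s z≤n
  row>0⇒< (_ ∷ λs) {suc i} h = s≤s (row>0⇒< λs h)

  row≤sum : ∀ λs i → row λs i ≤ sum λs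
  row≤sum []       _       = z≤n
  row≤sum (p ∷ λs) zero    = m≤m+n p (sum λs)
  row≤sum (p ∷ λs) (suc i) = ≤-trans (row≤sum λs i) (m≤n+m (sum λs) p)

  -- Positivity of the parts makes containment control the number of parts.
  ⊆⇒length≤ : ∀ {μs} λs → All (0 <_) μs → μs ⊆ λs → length μs ≤ length λs
  ⊆⇒length≤ {[]}     _        _        _ = z≤n
  ⊆⇒length≤ {_ ∷ _}  []       (p ∷ _)  c = contradiction (≤-trans p (c 0)) λ ()
  ⊆⇒length≤ {_ ∷ _}  (_ ∷ λs) (_ ∷ ps) c = s≤s (⊆⇒length≤ λs ps (c ∘ suc))

  partition? : ∀ λs → Dec (IsPartition λs)
  partition? λs = map′ (λ (d , p) → isPartition d p)
                       (λ (isPartition d p) → d , p)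
                       (Linked.linked? _≥?_ λs ×-dec All.all? (0 <?_) λs)

  ⊆? : ∀ μs λs → Dec (μs ⊆ λs)
  ⊆? []       λs       = yes λ _ → z≤n
  ⊆? (m ∷ μs) []       = map′ (λ { (m≤ , c) zero → m≤ ; (m≤ , c) (suc i) → c i })
                              (λ c → c 0 , c ∘ suc) ((m ≤? 0) ×-dec ⊆? μs [])
  ⊆? (m ∷ μs) (p ∷ λs) = map′ (λ { (m≤ , c) zero → m≤ ; (m≤ , c) (suc i) → c i })
                              (λ c → c 0 , c ∘ suc) ((m ≤? p) ×-dec ⊆? μs λs)

  module _ (λs μs : List ℕ) where

    skew? : ∀ x → Dec (x ∈[ λs / μs ])
    skew? (i , j) = (row μs i ≤? j) ×-dec (j <? row λs i)

    grid : List Box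
    grid = cartesianProduct (upTo (length λs)) (upTo (sum λs))

    skew⇒∈grid : ∀ {x} → x ∈[ λs / μs ] → x ∈ grid
    skew⇒∈grid {i , _} (_ , h) =
      ∈-cartesianProduct⁺ (∈-upTo⁺ (row>0⇒< λs h)) (∈-upTo⁺ (<-≤-trans h (row≤sum λs i)))

    ∀skew? : ∀ {P : Box → Set} → (∀ x → Dec (P x)) → Dec (∀ x → x ∈[ λs / μs ] → P x)
    ∀skew? P? = map′ (λ h x m → All.lookup h (skew⇒∈grid m) m)
                     (λ h → All.tabulate λ {x} _ → h x)
                     (All.all? (λ x → skew? x →-dec P? x) grid)

    step? : ∀ x y → Dec (Step λs μs x y)
    step? x@(i , j) y@(k , l) = skew? x ×-dec skew? y ×-dec (∣ i - k ∣ + ∣ j - l ∣ ≟ 1)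

    open Reachability (≡-dec _≟_ _≟_) step? using (star?)

    connected? : Dec (Connected λs μs)
    connected? = map′ (λ h x y m n → h x m y n) (λ h x m y n → h x y m n)
      (∀skew? λ x → ∀skew? λ y → star? grid (λ (_ , m , _) → skew⇒∈grid m) x y)

    no2×2? : Dec (No2×2 λs μs)
    no2×2? = map′ (λ h i j (a , bcd) → h (i , j) a bcd) (λ h (i , j) a bcd → h i j (a , bcd))
      (∀skew? λ (i , j) → ¬? (skew? (i , suc j) ×-dec skew? (suc i , j) ×-dec skew? (suc i , suc j)))

  removeRimHook? : ∀ t λs μs → Dec (RemoveRimHook t λs μs)
  removeRimHook? t λs μs =
    map′ (λ (p , c , d , n , b) → removeRimHook p c d n b)
         (λ (removeRimHook p c d n b) → p , c , d , n , b)
         (partition? μs ×-dec ⊆? μs λs ×-dec connected? λs μs ×-dec no2×2? λs μs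
           ×-dec (sum λs ≟ sum μs + t))

  ∃removeRimHook? : ∀ t λs → Dec (∃[ μs ] RemoveRimHook t λs μs)
  ∃removeRimHook? t λs =
    map′ (λ a → let μs , _ , h = find a in μs , h)
         (λ (μs , h) → lose (candidate h) h)
         (Any.any? (removeRimHook? t λs) (𝒫 (length λs) (row λs 0)))
    where
    candidate : ∀ {μs} → RemoveRimHook t λs μs → μs ∈ 𝒫 (length λs) (row λs 0)
    candidate (removeRimHook p c _ _ _) =
      ∈𝒫⁺ _ _ (inRectangle p (⊆⇒length≤ λs (IsPartition.positive p) c) (c 0))

  coreAcc : ∀ t .{{_ : NonZero t}} λs → Acc _<_ (sum λs) → ∃[ κs ] IsCoreOf t λs κs
  coreAcc t λs (acc rec) with ∃removeRimHook? t λs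
  ... | no ¬h        = λs , ε , ¬h
  ... | yes (μs , h) =
    let κs , hs , stop = coreAcc t μs (rec smaller) in κs , h ◅ hs , stop
    where
    smaller : sum μs < sum λs
    smaller = subst (sum μs <_) (sym (RemoveRimHook.boxes h)) (m<m+n (sum μs) (>-nonZero⁻¹ t))

core-exists : ∀ t .{{_ : NonZero t}} λs → ∃[ κs ] IsCoreOf t λs κs
core-exists t λs = coreAcc t λs (<-wellFounded (sum λs))

core : ∀ t .{{_ : NonZero t}} → List ℕ → List ℕ
core t λs = proj₁ (core-exists t λs)

core-isCore : ∀ t .{{_ : NonZero t}} λs → IsCoreOf t λs (core t λs)
core-isCore t λs = proj₂ (core-exists t λs)

------------------------------------------------------------------------
-- Expectation

-- The expectation of f(λ) for λ uniformly distributed on 𝒫_{r,s}.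
𝔼 : (r s : ℕ) → (List ℕ → ℕ) → ℚ
𝔼 r s f = _/ℚ_ (+ sum (map f (𝒫 r s))) (length (𝒫 r s)) {{𝒫-nonEmpty r s}}

[r+s][r+s-1]≢0 : ∀ r s .{{_ : NonZero r}} .{{_ : NonZero s}} →
                 NonZero ((r + s) * (r + s ∸ 1))
[r+s][r+s-1]≢0 (suc r) (suc s) rewrite +-suc r s = _

-- Encode λ ∈ 𝒫_{r,s} by its r bead positions λᵢ + (r − 1 − i), an r-subset of {0,…,n−1}
-- with n = r + s.  Removing a t-rim hook moves one bead from z + t to the vacant position z,
-- so the residues of the beads modulo t are invariant, and in the t-core the beads are
-- flush: z + t occupied forces z occupied.  For a flush set B the bead x has exactly ⌊x/t⌋
-- congruent beads below it, hence
--   |core_t(λ)| + C(r,2) = Σ_{x ∈ B} (x mod t) + t · #{pairs of congruent beads},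
-- where the right side depends on residues only and may be computed for λ itself.
-- Averaging over all r-subsets weights the single positions with r/n and the pairs with
-- r(r−1)/(n(n−1)).  The same identity for the full (flush) set {0,…,n−1} eliminates the number
-- of congruent pairs, and Σ_{x<n} (x mod t) is evaluated by division with remainder.

module Submission where

open import Algebra.Properties.CommutativeSemigroup using (interchange)
open import Data.Bool using (if_then_else_)
open import Data.Nat using (ℕ; zero; suc; _+_; _*_; _∸_; _/_; _%_; _≤_; _<_; _>_; _≥_; z≤n; s≤s; _≤′_; ≤′-refl; ≤′-step; ∣_-_∣; NonZero; NonTrivial; nonTrivial⇒nonZero; >-nonZero⁻¹; ≢-nonZero⁻¹)
open import Data.Nat.Combinatorics using (_C_; nC1≡n; nCk+nC[k+1]≡[n+1]C[k+1])
open import Data.Nat.DivMod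
open import Data.Nat.ListAction using (sum)
open import Data.Nat.ListAction.Properties using (sum-++; sum-↭)
open import Data.Nat.Properties
open import Data.Nat.Tactic.RingSolver using (solve-∀)
open import Data.List using (List; []; _∷_; _++_; _∷ʳ_; length; map; concat; upTo; downFrom)
open import Data.List.Properties using (map-++; map-∘; map-cong; map-cong-local; concat-++; ++-identityʳ; upTo-∷ʳ; length-downFrom)
open import Data.List.Membership.DecPropositional _≟_ using (_∈?_)
open import Data.List.Membership.Propositional using (_∈_; _∉_)
open import Data.List.Membership.Propositional.Properties using (∈-downFrom⁺; ∈-downFrom⁻)
open import Data.List.Relation.Binary.Permutation.Propositional using (_↭_; refl; prep; swap; ↭-refl; ↭-trans; ↭-reflexive) renaming (trans to ↭trans)
open import Data.List.Relation.Binary.Permutation.Propositional.Properties using (map⁺)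
open import Data.List.Relation.Unary.All as All using (All; []; _∷_)
open import Data.List.Relation.Unary.AllPairs using (AllPairs; []; _∷_)
open import Data.List.Relation.Unary.Any using (here; there)
open import Data.List.Relation.Unary.Linked using (Linked; []; [-]; _∷_)
open import Data.Product using (∃-syntax; _×_; _,_; proj₁; proj₂)
open import Data.Sum using (_⊎_; inj₁; inj₂)
open import Function using (_∘_)
open import Function.Bundles using (Equivalence)
open import Relation.Binary using (tri<; tri≈; tri>)
open import Relation.Binary.Construct.Closure.ReflexiveTransitive using (Star; ε; _◅_; _◅◅_; gmap; reverse)
open import Relation.Binary.PropositionalEquality using (_≡_; _≢_; _≗_; refl; sym; trans; cong; cong₂; subst; module ≡-Reasoning)
open import Relation.Nullary using (¬_; yes; no; does; contradiction)
open import Relation.Nullary.Decidable using (dec-true; dec-false)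
open import Defs

-- Bead positions of a partition

+-interchange : ∀ a b c d → a + b + (c + d) ≡ a + c + (b + d)
+-interchange = interchange +-commutativeSemigroup

-- Row lengths form a function on all of ℕ, so dropping the top row is `f ∘ suc` and missing parts
-- count as zero rows. For decreasing `f` the list is strictly decreasing and so stands for a set.
beads : ℕ → (ℕ → ℕ) → List ℕ
beads zero    f = []
beads (suc r) f = f 0 + r ∷ beads r (f ∘ suc)

beads-[] : ∀ r → beads r (row []) ≡ downFrom r
beads-[] zero    = refl
beads-[] (suc r) = cong (r ∷_) (beads-[] r)

beads-cong : ∀ r {f g} → f ≗ g → beads r f ≡ beads r g
beads-cong zero    _ = refl
beads-cong (suc r) e = cong₂ _∷_ (cong (_+ r) (e 0)) (beads-cong r (e ∘ suc))

Decreasing : (ℕ → ℕ) → Set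
Decreasing f = ∀ i → f (suc i) ≤ f i

VanishesFrom : ℕ → (ℕ → ℕ) → Set
VanishesFrom r f = ∀ i → f (r + i) ≡ 0

row-decreasing : ∀ {λs} → Linked _≥_ λs → Decreasing (row λs)
row-decreasing []      _       = z≤n
row-decreasing [-]     _       = z≤n
row-decreasing (h ∷ _) zero    = h
row-decreasing (_ ∷ l) (suc i) = row-decreasing l i

row-vanishesFrom : ∀ {r} λs → length λs ≤ r → VanishesFrom r (row λs)
row-vanishesFrom []       _         _ = refl
row-vanishesFrom (_ ∷ λs) (s≤s len) i = row-vanishesFrom λs len i

sum-beads : ∀ r λs → length λs ≤ r → sum (beads r (row λs)) ≡ sum λs + sum (downFrom r)
sum-beads r       []       _         = cong sum (beads-[] r)
sum-beads (suc r) (p ∷ λs) (s≤s len) = begin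
  p + r + sum (beads r (row λs))            ≡⟨ cong (p + r +_) (sum-beads r λs len) ⟩
  p + r + (sum λs + sum (downFrom r)) ≡⟨ +-interchange p r (sum λs) _ ⟩
  p + sum λs + (r + sum (downFrom r)) ∎
  where open ≡-Reasoning

length-mono : ∀ {μs} λs → All (0 <_) μs → μs ⊆ λs → length μs ≤ length λs
length-mono {[]}    _        _       _ = z≤n
length-mono {_ ∷ _} []       (p ∷ _) c = contradiction (≤-trans p (c 0)) λ ()
length-mono {_ ∷ _} (_ ∷ λs) (_ ∷ p) c = s≤s (length-mono λs p (c ∘ suc))

-- Hooks are built below as row functions; cutting such a function at its first zero recovers a list
-- with positive parts.
trim : ℕ → (ℕ → ℕ) → List ℕ
trim zero    f = []
trim (suc r) f with f 0
... | zero  = []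
... | suc p = suc p ∷ trim r (f ∘ suc)

vanishes-everywhere : ∀ {f} → Decreasing f → f 0 ≡ 0 → ∀ i → f i ≡ 0
vanishes-everywhere d e zero    = e
vanishes-everywhere d e (suc i) = n≤0⇒n≡0 (≤-trans (d i) (≤-reflexive (vanishes-everywhere d e i)))

row-trim : ∀ r {f} → Decreasing f → VanishesFrom r f → row (trim r f) ≗ f
row-trim zero        d v i = sym (v i)
row-trim (suc r) {f} d v i with f 0 in e
row-trim (suc r) {f} d v i       | zero  = sym (vanishes-everywhere d e i)
row-trim (suc r) {f} d v zero    | suc p = sym e
row-trim (suc r) {f} d v (suc i) | suc p = row-trim r (d ∘ suc) v i

length-trim : ∀ r f → length (trim r f) ≤ r
length-trim zero    f = z≤n
length-trim (suc r) f with f 0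
... | zero  = z≤n
... | suc p = s≤s (length-trim r (f ∘ suc))

trim-positive : ∀ r f → All (0 <_) (trim r f)
trim-positive zero    f = []
trim-positive (suc r) f with f 0
... | zero  = []
... | suc p = s≤s z≤n ∷ trim-positive r (f ∘ suc)

linked : ∀ λs → Decreasing (row λs) → Linked _≥_ λs
linked []           d = []
linked (p ∷ [])     d = [-]
linked (p ∷ q ∷ λs) d = d 0 ∷ linked (q ∷ λs) (d ∘ suc)

trim-isPartition : ∀ r {f} → Decreasing f → VanishesFrom r f → IsPartition (trim r f)
trim-isPartition r {f} d v = isPartition (linked _ dec) (trim-positive r f)
  where
  dec : Decreasing (row (trim r f))
  dec i rewrite row-trim r d v (suc i) | row-trim r d v i = d i

-- Rim hooks as moves of a single bead

-- f and g are the row lengths of λ and μ, where λ/μ is a rim hook with top row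
-- 0 and z is the position of the bead that `beads (suc r) g` gains.
data Strip : ℕ → (ℕ → ℕ) → (ℕ → ℕ) → ℕ → Set where
  last : ∀ {r f g z} → g 0 < f 0 → f ∘ suc ≗ g ∘ suc → g 0 + r ≡ z → Strip r f g z
  more : ∀ {r f g z} → f 1 ≡ suc (g 0) → Strip r (f ∘ suc) (g ∘ suc) z → Strip (suc r) f g z

-- The rim hook may start in any row; the bead at x is moved to z.
data Hook : ℕ → (ℕ → ℕ) → (ℕ → ℕ) → ℕ → ℕ → Set where
  start : ∀ {r f g z} → Strip r f g z → Hook (suc r) f g (f 0 + r) z
  skip  : ∀ {r f g x z} → f 0 ≡ g 0 → Hook r (f ∘ suc) (g ∘ suc) x z → Hook (suc r) f g x z

strip-cong : ∀ {r f g h z} → g ≗ h → Strip r f g z → Strip r f h z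
strip-cong {r} {f} e (last l s b) =
  last (subst (_< f 0) (e 0) l) (λ i → trans (s i) (e (suc i))) (trans (cong (_+ r) (sym (e 0))) b)
strip-cong e (more o s) = more (trans o (cong suc (e 0))) (strip-cong (e ∘ suc) s)

hook-cong : ∀ {r f g h x z} → g ≗ h → Hook r f g x z → Hook r f h x z
hook-cong e (start s)  = start (strip-cong e s)
hook-cong e (skip o s) = skip (trans o (e 0)) (hook-cong (e ∘ suc) s)

-- Above the last row of the strip, `f 1 ≡ suc (g 0)` puts the top bead of `g` where the second bead
-- of `f` was. So only the top bead of `f` is lost and only `z` is new.
beads-strip : ∀ {r f g z} → Strip r f g z → beads (suc r) g ↭ z ∷ beads r (f ∘ suc)
beads-strip {r} (last _ e refl) = prep _ (↭-reflexive (beads-cong r (sym ∘ e)))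
beads-strip {suc r} {f} {g} {z} (more e s) =
  ↭-trans (↭-reflexive (cong (_∷ beads (suc r) (g ∘ suc)) bead)) (↭-trans (prep _ (beads-strip s)) (swap _ _ ↭-refl))
  where
  bead : g 0 + suc r ≡ f 1 + r
  bead = trans (+-suc (g 0) r) (cong (_+ r) (sym e))

beads-hook : ∀ {r f g x z} → Hook r f g x z → ∃[ C ] (beads r f ↭ x ∷ C) × (beads r g ↭ z ∷ C)
beads-hook (start s) = _ , ↭-refl , beads-strip s
beads-hook {suc r} {f} {g} (skip e h) =
  let C , p , q = beads-hook h in
  f 0 + r ∷ C , ↭-trans (prep _ p) (swap _ _ ↭-refl)
  , ↭-trans (↭-reflexive (cong (λ m → m + r ∷ _) (sym e))) (↭-trans (prep _ q) (swap _ _ ↭-refl))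

strip-top : ∀ {r f g z} → Decreasing f → Strip r f g z → g 0 < f 0
strip-top d (last l _ _) = l
strip-top d (more e _)   = ≤-trans (≤-reflexive (sym e)) (d 0)

strip-≤ : ∀ {r f g z} → Decreasing f → Strip r f g z → ∀ i → g i ≤ f i
strip-≤ d s            zero    = <⇒≤ (strip-top d s)
strip-≤ d (last _ e _) (suc i) = ≤-reflexive (sym (e i))
strip-≤ d (more _ s)   (suc i) = strip-≤ (d ∘ suc) s i

hook-≤ : ∀ {r f g x z} → Decreasing f → Hook r f g x z → ∀ i → g i ≤ f i
hook-≤ d (start s)  i       = strip-≤ d s i
hook-≤ d (skip e h) zero    = ≤-reflexive (sym e)
hook-≤ d (skip e h) (suc i) = hook-≤ (d ∘ suc) h i

-- The columns shared by rows `i` and `suc i` of the skew shape start at `g i` and end before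
-- `f (suc i)`; the bound leaves at most one, which excludes 2×2 blocks.
strip-overlap : ∀ {r f g z} → Decreasing g → Strip r f g z → ∀ i → f (suc i) ≤ suc (g i)
strip-overlap d (last _ e _) i       = m≤n⇒m≤1+n (≤-trans (≤-reflexive (e i)) (d i))
strip-overlap d (more e s)   zero    = ≤-reflexive e
strip-overlap d (more e s)   (suc i) = strip-overlap (d ∘ suc) s i

hook-overlap : ∀ {r f g x z} → Decreasing f → Decreasing g → Hook r f g x z → ∀ i → f (suc i) ≤ suc (g i)
hook-overlap d d′ (start s)  i       = strip-overlap d′ s i
hook-overlap d d′ (skip e h) zero    = m≤n⇒m≤1+n (≤-trans (d 0) (≤-reflexive e))
hook-overlap d d′ (skip e h) (suc i) = hook-overlap (d ∘ suc) (d′ ∘ suc) h i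

-- Connectedness of hooks

Skew : (f g : ℕ → ℕ) → Box → Set
Skew f g (i , j) = g i ≤ j × j < f i

SkewStep : (f g : ℕ → ℕ) → Box → Box → Set
SkewStep f g x y = Skew f g x × Skew f g y × Adjacent x y

walk-back : ∀ f g {x y} → Star (SkewStep f g) x y → Star (SkewStep f g) y x
walk-back f g = reverse λ { {i , j} {k , l} (m , n , a) → n , m , trans (cong₂ _+_ (∣-∣-comm k i) (∣-∣-comm l j)) a }

∣n-1+n∣≡1 : ∀ n → ∣ n - suc n ∣ ≡ 1
∣n-1+n∣≡1 zero    = refl
∣n-1+n∣≡1 (suc n) = ∣n-1+n∣≡1 n

row-walk : ∀ {f g i j k} → j ≤′ k → g i ≤ j → k < f i → Star (SkewStep f g) (i , j) (i , k)
row-walk ≤′-refl _ _ = ε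
row-walk {i = i} (≤′-step {n = n} j≤n) lo hi =
  row-walk j≤n lo (<⇒≤ hi) ◅◅
  ((≤-trans lo (≤′⇒≤ j≤n) , <⇒≤ hi) , (m≤n⇒m≤1+n (≤-trans lo (≤′⇒≤ j≤n)) , hi)
  , cong₂ _+_ (∣n-n∣≡0 i) (∣n-1+n∣≡1 n)) ◅ ε

below : ∀ {f g x y} → Star (SkewStep (f ∘ suc) (g ∘ suc)) x y →
        Star (SkewStep f g) (suc (proj₁ x) , proj₂ x) (suc (proj₁ y) , proj₂ y)
below = gmap (λ (i , j) → suc i , j) λ s → s

strip-connected : ∀ {r f g z} → Decreasing f → Decreasing g → Strip r f g z →
                  ∀ {y} → Skew f g y → Star (SkewStep f g) (0 , g 0) y
strip-connected d d′ s            {zero  , j} (lo , hi) = row-walk (≤⇒≤′ lo) ≤-refl hi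
strip-connected d d′ (last _ e _) {suc i , j} (lo , hi) =
  contradiction (<-≤-trans hi (≤-trans (≤-reflexive (e i)) lo)) (<-irrefl refl)
-- The walk steps down in column `g 0`, which holds the last box of row 1 by `e`, and then runs left
-- to the base box `(1 , g 1)` of the shorter strip.
strip-connected {f = f} {g} d d′ (more e s) {suc i , j} m =
  ((≤-refl , ≤-trans (≤-reflexive (sym e)) (d 0)) , (d′ 0 , ≤-reflexive (sym e))
  , cong (1 +_) (∣n-n∣≡0 (g 0))) ◅
  walk-back f g (row-walk (≤⇒≤′ (d′ 0)) ≤-refl (≤-reflexive (sym e))) ◅◅
  below (strip-connected (d ∘ suc) (d′ ∘ suc) s m)

hook-connected : ∀ {r f g x z} → Decreasing f → Decreasing g → Hook r f g x z →
                 ∃[ b ] (∀ {y} → Skew f g y → Star (SkewStep f g) b y)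
hook-connected d d′ (start s)  = _ , strip-connected d d′ s
hook-connected {f = f} {g} d d′ (skip e h) = let b , c = hook-connected (d ∘ suc) (d′ ∘ suc) h in _ , walk b c
  where
  walk : ∀ b → (∀ {y} → Skew (f ∘ suc) (g ∘ suc) y → Star (SkewStep (f ∘ suc) (g ∘ suc)) b y) →
         ∀ {y} → Skew f g y → Star (SkewStep f g) (suc (proj₁ b) , proj₂ b) y
  walk b c {zero  , j} (lo , hi) = contradiction (<-≤-trans hi (≤-trans (≤-reflexive e) lo)) (<-irrefl refl)
  walk b c {suc i , j} m         = below (c m)

-- Moving a bead to a vacant position

cons : ℕ → (ℕ → ℕ) → ℕ → ℕ
cons p f zero    = p
cons p f (suc i) = f i

cons-decreasing : ∀ {p f} → f 0 ≤ p → Decreasing f → Decreasing (cons p f)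
cons-decreasing h d zero    = h
cons-decreasing h d (suc i) = d i

strip-last : ∀ r {f z} → Decreasing f → VanishesFrom (suc r) f → z < f 0 + r → f 1 + r ≤ z →
             ∃[ g ] Decreasing g × VanishesFrom (suc r) g × Strip r f g z
strip-last r {f} {z} d v hi lo =
  cons (z ∸ r) (f ∘ suc) , cons-decreasing (m+n≤o⇒m≤o∸n (f 1) lo) (d ∘ suc) , v
  , last (+-cancelʳ-< r (z ∸ r) (f 0) (≤-trans (≤-reflexive (cong suc z∸r+r≡z)) hi)) (λ _ → refl) z∸r+r≡z
  where
  z∸r+r≡z : z ∸ r + r ≡ z
  z∸r+r≡z = m∸n+n≡m (≤-trans (m≤n+m r (f 1)) lo)

-- Compare `z` with the next bead: if `z` is larger, the strip ends in this row; equality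
-- contradicts the vacancy; if `z` is smaller, the strip continues into the next row.
strip-exists : ∀ r {f z} → Decreasing f → VanishesFrom (suc r) f → z < f 0 + r → z ∉ beads r (f ∘ suc) →
               ∃[ g ] Decreasing g × VanishesFrom (suc r) g × Strip r f g z
strip-exists zero {f} {z} d v hi z∉ =
  strip-last 0 d v hi (≤-trans (≤-reflexive (trans (+-identityʳ (f 1)) (v 0))) z≤n)
strip-exists (suc r) {f} {z} d v hi z∉ with <-cmp z (f 1 + r)
-- Strictness absorbs the shift by one from `f 1 + r` to the required `f 1 + suc r`.
... | tri> _ _ lo = strip-last (suc r) d v hi (≤-trans (≤-reflexive (+-suc (f 1) r)) lo)
... | tri≈ _ e _  = contradiction (here e) z∉
... | tri< hi′ _ _ with strip-exists r (d ∘ suc) v hi′ (z∉ ∘ there)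
-- The recursive strip shortens row 1, so `f 1` is some `suc p`, and `p` is the new length of row 0.
... | g , d′ , v′ , s with f 1 in e | strip-top (d ∘ suc) s
... | suc p | s≤s g≤p = cons p g , cons-decreasing g≤p d′ , v′ , more e s
... | zero  | ()

hook-exists : ∀ r {f x z} → Decreasing f → VanishesFrom r f → x ∈ beads r f → z < x → z ∉ beads r f →
              ∃[ g ] Decreasing g × VanishesFrom r g × Hook r f g x z
hook-exists (suc r) d v (here refl) z<x z∉ =
  let g , d′ , v′ , s = strip-exists r d v z<x (z∉ ∘ there) in g , d′ , v′ , start s
hook-exists (suc r) {f} d v (there m) z<x z∉ =
  let g , d′ , v′ , h = hook-exists r (d ∘ suc) v m z<x (z∉ ∘ there)
  in cons (f 0) g , cons-decreasing (≤-trans (hook-≤ (d ∘ suc) h 0) (d 0)) d′ , v′ , skip refl h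

-- Bead sums are sizes shifted by the constant `sum (downFrom r)`, and the two bead lists differ
-- only in `x` and `z`.
sum-hook : ∀ {r x z} λs μs → length λs ≤ r → length μs ≤ r →
           Hook r (row λs) (row μs) x z → sum λs + z ≡ sum μs + x
sum-hook {r} {x} {z} λs μs l l′ h with C , p , q ← beads-hook h =
  +-cancelʳ-≡ (sum (downFrom r) + sum C) _ _ (begin
    sum λs + z + (K + sum C)   ≡⟨ +-interchange (sum λs) z K (sum C) ⟩
    sum λs + K + (z + sum C)   ≡⟨ cong₂ _+_ (trans (sym (sum-beads r λs l)) (sum-↭ p)) (trans (sym (sum-↭ q)) (sum-beads r μs l′)) ⟩
    x + sum C + (sum μs + K)   ≡⟨ regroup (sum μs) x K (sum C) ⟩
    sum μs + x + (K + sum C)   ∎)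
  where
  open ≡-Reasoning
  K = sum (downFrom r)
  regroup : ∀ a b c d → b + d + (a + c) ≡ a + b + (c + d)
  regroup = solve-∀

-- Sliding the bead from `z + t` down to the vacancy `z` is a hook, and the distance moved is its
-- number of boxes.
removable : ∀ {r t z λs} .{{_ : NonZero t}} → IsPartition λs → length λs ≤ r →
            z + t ∈ beads r (row λs) → z ∉ beads r (row λs) → ∃[ μs ] RemoveRimHook t λs μs
removable {r} {t} {z} {λs} (isPartition l _) len x∈ z∉
  with g , dg , vg , h₀ ← hook-exists r (row-decreasing l) (row-vanishesFrom λs len) x∈ (m<m+n z (>-nonZero⁻¹ t)) z∉
  = trim r g , removeRimHook μ-partition (hook-≤ d h) connected
      -- A block with upper left corner `(i , j)` would have `row (trim r g) i ≤ j` and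
      -- `suc j < row λs (suc i)`, against `hook-overlap`.
      (λ { i j ((lo , _) , _ , _ , (_ , hi)) → contradiction (≤-trans hi (≤-trans (hook-overlap d d′ h i) (s≤s lo))) (<-irrefl refl) })
      (+-cancelʳ-≡ z _ _ (trans (sum-hook λs (trim r g) len (length-trim r g) h) (trans (cong (sum (trim r g) +_) (+-comm z t)) (sym (+-assoc (sum (trim r g)) t z)))))
  where
  μ-partition : IsPartition (trim r g)
  μ-partition = trim-isPartition r dg vg
  d : Decreasing (row λs)
  d = row-decreasing l
  d′ : Decreasing (row (trim r g))
  d′ = row-decreasing (IsPartition.decreasing μ-partition)
  h : Hook r (row λs) (row (trim r g)) (z + t) z
  h = hook-cong (sym ∘ row-trim r dg vg) h₀
  connected : Connected λs (trim r g)
  connected x y m n = let b , c = hook-connected d d′ h in walk-back (row λs) (row (trim r g)) (c m) ◅◅ c n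

-- Every rim hook is a bead move

adjacent-down : ∀ i k {j l} → i < k → Adjacent (i , j) (k , l) → k ≡ suc i × j ≡ l
adjacent-down (suc i) (suc k)       (s≤s i<k) a = let e , e′ = adjacent-down i k i<k a in cong suc e , e′
adjacent-down zero    (suc zero)    _         a = refl , ∣m-n∣≡0⇒m≡n (suc-injective a)
adjacent-down zero    (suc (suc k)) _         ()

-- The walk must at some point step from row `j` to row `suc j` within one column, and that column
-- lies in both rows.
crossing : ∀ {f g x y} j → Star (SkewStep f g) x y → proj₁ x ≤ j → j < proj₁ y → g j < f (suc j)
crossing j ε x≤j j<y = contradiction (<-≤-trans j<y x≤j) (<-irrefl refl)
crossing j (_◅_ {i , m} {k , n} ((lo , _) , (_ , hi) , a) w) i≤j j<y with k ≤? j
... | yes k≤j = crossing j w k≤j j<y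
... | no  k≰j with adjacent-down i k {m} {n} (≤-<-trans i≤j (≰⇒> k≰j)) a
... | refl , refl with ≤-antisym i≤j (≤-pred (≰⇒> k≰j))
... | refl = ≤-<-trans lo hi

-- Rim-hook conditions as inequalities between row lengths, a form that survives dropping the top
-- row: `thin` comes from the absence of 2×2 blocks, `crosses` from connectedness.
record Ribbon (f g : ℕ → ℕ) : Set where
  field
    g-decreasing : Decreasing g
    g≤f          : ∀ i → g i ≤ f i
    thin         : ∀ i → f (suc i) ≤ suc (g i)
    crosses      : ∀ {i j k} → i ≤ j → j < k → g i < f i → g k < f k → g j < f (suc j)

open Ribbon

ribbon-below : ∀ {f g} → Ribbon f g → Ribbon (f ∘ suc) (g ∘ suc)
ribbon-below R = record
  { g-decreasing = g-decreasing R ∘ suc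
  ; g≤f          = g≤f R ∘ suc
  ; thin         = thin R ∘ suc
  ; crosses      = λ i≤j j<k → crosses R (s≤s i≤j) (s≤s j<k)
  }

removed-ribbon : ∀ {t λs μs} → IsPartition λs → RemoveRimHook t λs μs → Ribbon (row λs) (row μs)
removed-ribbon {λs = λs} {μs} (isPartition l _) (removeRimHook (isPartition l′ _) μ⊆λ conn no2×2 _) = record
  { g-decreasing = d′
  ; g≤f          = μ⊆λ
  -- Otherwise rows `i` and `suc i` would contain a 2×2 block starting at column `row μs i`.
  ; thin         = λ i → ≮⇒≥ λ h → no2×2 i (row μs i)
      ((≤-refl , ≤-trans (<⇒≤ h) (d i)) , (n≤1+n _ , ≤-trans h (d i)) , (d′ i , <⇒≤ h) , (m≤n⇒m≤1+n (d′ i) , h))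
  ; crosses      = λ {i} {j} {k} i≤j j<k p q → crossing j (conn (i , row μs i) (k , row μs k) (≤-refl , p) (≤-refl , q)) i≤j j<k
  }
  where
  d : Decreasing (row λs)
  d = row-decreasing l
  d′ : Decreasing (row μs)
  d′ = row-decreasing l′

-- While the next row is nonempty, `thin` and `crosses` bound its overlap with the current row by
-- one from both sides, which is the equation in `more`. The strip ends before the first empty row.
ribbon-strip : ∀ r {f g} → VanishesFrom (suc r) f → Ribbon f g → g 0 < f 0 → ∃[ z ] Strip r f g z
ribbon-strip zero {f} {g} v R l =
  _ , last l (λ i → trans (v i) (sym (n≤0⇒n≡0 (≤-trans (g≤f R (suc i)) (≤-reflexive (v i)))))) refl
ribbon-strip (suc r) {f} {g} v R l with g 1 <? f 1
... | yes l′ = let z , s = ribbon-strip r v (ribbon-below R) l′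
               in z , more (≤-antisym (thin R 0) (crosses R ≤-refl ≤-refl l l′)) s
... | no ¬l′ = _ , last l (λ i → ≤-antisym (≮⇒≥ (below≤ i)) (g≤f R (suc i))) refl
  where
  below≤ : ∀ i → ¬ (g (suc i) < f (suc i))
  -- A nonempty lower row would force `g 0 < f 1` by `crosses`, and with `g 1 ≤ g 0` row 1 would be
  -- nonempty.
  below≤ i p = ¬l′ (≤-<-trans (g-decreasing R 0) (crosses R z≤n (s≤s z≤n) l p))

-- The strip starts in the first nonempty row of the skew shape. The left alternative covers the
-- empty shape, which a box count excludes later.
ribbon-hook : ∀ r {f g} → VanishesFrom r f → Ribbon f g → beads r f ≡ beads r g ⊎ ∃[ x ] ∃[ z ] Hook r f g x z
ribbon-hook zero    v R = inj₁ refl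
ribbon-hook (suc r) {f} {g} v R with m≤n⇒m<n∨m≡n (g≤f R 0)
... | inj₁ l = let z , s = ribbon-strip r v R l in inj₂ (_ , z , start s)
... | inj₂ e with ribbon-hook r v (ribbon-below R)
... | inj₁ b           = inj₁ (cong₂ _∷_ (cong (_+ r) (sym e)) b)
... | inj₂ (x , z , h) = inj₂ (x , z , skip (sym e) h)

removed-length : ∀ {t λs μs} → RemoveRimHook t λs μs → length μs ≤ length λs
removed-length {λs = λs} (removeRimHook (isPartition _ p) μ⊆λ _ _ _) = length-mono λs p μ⊆λ

removed-bead : ∀ {r t λs μs} .{{_ : NonZero t}} → IsPartition λs → length λs ≤ r → RemoveRimHook t λs μs →
               ∃[ z ] ∃[ C ] (beads r (row λs) ↭ z + t ∷ C) × (beads r (row μs) ↭ z ∷ C)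
removed-bead {r} {t} {λs} {μs} P len R with ribbon-hook r (row-vanishesFrom λs len) (removed-ribbon P R)
-- Equal beads would give equal sizes, but the sizes differ by the nonzero `t`.
... | inj₁ e = contradiction (+-cancelʳ-≡ (sum (downFrom r)) _ _
                 (trans (sym (sum-beads r λs len)) (trans (cong sum e) (sum-beads r μs (≤-trans (removed-length R) len)))))
                 λ e′ → ≢-nonZero⁻¹ t (+-cancelˡ-≡ (sum μs) t 0 (trans (sym (RemoveRimHook.boxes R)) (trans e′ (sym (+-identityʳ _)))))
... | inj₂ (x , z , h) with C , p , q ← beads-hook h = z , C , subst (λ y → beads r (row λs) ↭ y ∷ C) x≡z+t p , q
  where
  open ≡-Reasoning
  x≡z+t : x ≡ z + t
  x≡z+t = +-cancelˡ-≡ (sum μs) x (z + t) (begin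
    sum μs + x       ≡⟨ sum-hook λs μs len (≤-trans (removed-length R) len) h ⟨
    sum λs + z       ≡⟨ cong (_+ z) (RemoveRimHook.boxes R) ⟩
    sum μs + t + z   ≡⟨ trans (+-assoc (sum μs) t z) (cong (sum μs +_) (+-comm t z)) ⟩
    sum μs + (z + t) ∎)

-- Residues of beads

pairSum : (ℕ → ℕ → ℕ) → List ℕ → ℕ
pairSum b []       = 0
pairSum b (x ∷ xs) = sum (map (b x) xs) + pairSum b xs

pairSum-↭ : ∀ {b} → (∀ x y → b x y ≡ b y x) → ∀ {xs ys} → xs ↭ ys → pairSum b xs ≡ pairSum b ys
pairSum-↭ b-sym refl       = refl
pairSum-↭ b-sym (prep x p) = cong₂ _+_ (sum-↭ (map⁺ _ p)) (pairSum-↭ b-sym p)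
pairSum-↭ b-sym (↭trans p q) = trans (pairSum-↭ b-sym p) (pairSum-↭ b-sym q)
pairSum-↭ {b} b-sym (swap {xs} {ys} x y p)
  rewrite b-sym x y | sum-↭ (map⁺ (b x) p) | sum-↭ (map⁺ (b y) p) | pairSum-↭ b-sym p =
  +-interchange (b y x) (sum (map (b x) ys)) (sum (map (b y) ys)) (pairSum b ys)

δ : ℕ → ℕ → ℕ
δ m n = if does (m ≟ n) then 1 else 0

δ-≡ : ∀ {m n} → m ≡ n → δ m n ≡ 1
δ-≡ {m} {n} e rewrite dec-true (m ≟ n) e = refl

δ-≢ : ∀ {m n} → m ≢ n → δ m n ≡ 0
δ-≢ {m} {n} e rewrite dec-false (m ≟ n) e = refl

δ-sym : ∀ m n → δ m n ≡ δ n m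
δ-sym m n with m ≟ n
... | yes m≡n = trans (δ-≡ m≡n) (sym (δ-≡ (sym m≡n)))
... | no  m≢n = trans (δ-≢ m≢n) (sym (δ-≢ (m≢n ∘ sym)))

Descending : List ℕ → Set
Descending = AllPairs _>_

module _ (t : ℕ) .{{_ : NonZero t}} where

  congruent : ℕ → ℕ → ℕ
  congruent x y = δ (x % t) (y % t)

  -- Depends on residues only, so a bead move by `t` preserves it; on flush sets it is the sum of
  -- the beads, by `sum-flush`.
  weight : List ℕ → ℕ
  weight B = sum (map (_% t) B) + t * pairSum congruent B

  weight-↭ : ∀ {B C} → B ↭ C → weight B ≡ weight C
  weight-↭ p = cong₂ _+_ (sum-↭ (map⁺ (_% t) p))
                         (cong (t *_) (pairSum-↭ (λ x y → δ-sym (x % t) (y % t)) p))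

  weight-shift : ∀ z C → weight (z + t ∷ C) ≡ weight (z ∷ C)
  weight-shift z C = cong (λ m → m + sum (map (_% t) C) + t * (sum (map (δ m ∘ (_% t)) C) + pairSum congruent C))
                          ([m+n]%n≡m%n z t)

  core-weight : ∀ {r λs κs} → IsPartition λs → length λs ≤ r → Star (RemoveRimHook t) λs κs →
                IsPartition κs × length κs ≤ r × weight (beads r (row λs)) ≡ weight (beads r (row κs))
  core-weight P len ε = P , len , refl
  core-weight {r} {λs} P len (_◅_ {j = μs} R Rs) with removed-bead P len R
    | core-weight (RemoveRimHook.partition R) (≤-trans (removed-length R) len) Rs
  ... | z , C , p , q | Pκ , lenκ , w = Pκ , lenκ , (begin
    weight (beads r (row λs)) ≡⟨ weight-↭ p ⟩
    weight (z + t ∷ C)        ≡⟨ weight-shift z C ⟩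
    weight (z ∷ C)            ≡⟨ weight-↭ q ⟨
    weight (beads r (row μs)) ≡⟨ w ⟩
    _                         ∎)
    where open ≡-Reasoning

  -- Flush bead sets

  Flush : List ℕ → Set
  Flush B = ∀ {z} → z + t ∈ B → z ∈ B

  flush-tail : ∀ {x B} → Descending (x ∷ B) → Flush (x ∷ B) → Flush B
  flush-tail (x>B ∷ _) flush m with flush (there m)
  ... | there m′   = m′
  ... | here  refl = contradiction (≤-<-trans (m≤m+n _ t) (All.lookup x>B m)) (<-irrefl refl)

  flush-head : ∀ {x B} → Flush (x ∷ B) → ∀ {z} → z + t ≡ x → z ∈ B
  flush-head flush {z} e with flush (here e)
  ... | there m   = m
  ... | here refl = contradiction (m<m+n z (>-nonZero⁻¹ t)) (<-irrefl (sym e))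

  -- With equal residues, `y < x` would force a larger quotient, and so `y + t ≤ x`.
  incongruent : ∀ {x y} → y < x → x < y + t → x % t ≢ y % t
  incongruent {x} {y} y<x x<y+t e = contradiction y+t≤x (<⇒≱ x<y+t)
    where
    open ≤-Reasoning
    y/t<x/t : y / t < x / t
    y/t<x/t = *-cancelʳ-< t (y / t) (x / t) (+-cancelˡ-< (x % t) _ _ (begin-strict
      x % t + y / t * t ≡⟨ cong (_+ y / t * t) e ⟩
      y % t + y / t * t ≡⟨ m≡m%n+[m/n]*n y t ⟨
      y                 <⟨ y<x ⟩
      x                 ≡⟨ m≡m%n+[m/n]*n x t ⟩
      x % t + x / t * t ∎))
    y+t≤x : y + t ≤ x
    y+t≤x = begin
      y + t                       ≡⟨ cong (_+ t) (m≡m%n+[m/n]*n y t) ⟩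
      y % t + y / t * t + t       ≡⟨ +-assoc (y % t) _ t ⟩
      y % t + (y / t * t + t)     ≡⟨ cong₂ _+_ (sym e) (+-comm _ t) ⟩
      x % t + suc (y / t) * t     ≤⟨ +-monoʳ-≤ (x % t) (*-monoˡ-≤ t y/t<x/t) ⟩
      x % t + x / t * t           ≡⟨ m≡m%n+[m/n]*n x t ⟨
      x                           ∎

  -- The beads congruent to x below a flush x are exactly x − t, x − 2t, … ≥ 0.
  count-congruent : ∀ {x} B → All (_< x) B → Descending B → Flush B → (∀ {z} → z + t ≡ x → z ∈ B) →
                    sum (map (congruent x) B) ≡ x / t
  count-congruent {x} [] _ _ _ vacant with x <? t
  ... | yes x<t = sym (m<n⇒m/n≡0 x<t)
  ... | no  x≮t with () ← vacant (m∸n+n≡m (≮⇒≥ x≮t))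
  count-congruent {x} (y ∷ B) (y<x ∷ B<x) D@(B<y ∷ D′) flush reached with <-cmp x (y + t)
  ... | tri< x<y+t x≢y+t _ rewrite δ-≢ (incongruent y<x x<y+t) =
    count-congruent B B<x D′ (flush-tail D flush) reached′
    where
    reached′ : ∀ {z} → z + t ≡ x → z ∈ B
    reached′ e with reached e
    ... | there m   = m
    ... | here refl = contradiction (sym e) x≢y+t
  -- The position `x ∸ t` must be occupied, so it cannot exceed the largest remaining bead `y`.
  ... | tri> _ _ x>y+t = contradiction (≤y (reached z+t≡x)) (<⇒≱ (+-cancelʳ-< t y (x ∸ t) (<-≤-trans x>y+t (≤-reflexive (sym z+t≡x)))))
    where
    z+t≡x : x ∸ t + t ≡ x
    z+t≡x = m∸n+n≡m (≤-trans (m≤n+m t y) (<⇒≤ x>y+t))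
    ≤y : ∀ {z} → z ∈ y ∷ B → z ≤ y
    ≤y (here refl) = ≤-refl
    ≤y (there m)   = <⇒≤ (All.lookup B<y m)
  count-congruent (y ∷ B) (y<x ∷ B<x) D@(B<y ∷ D′) flush reached | tri≈ _ refl _ = begin
    congruent (y + t) y + sum (map (congruent (y + t)) B)
      ≡⟨ cong₂ _+_ (δ-≡ ([m+n]%n≡m%n y t)) (cong (λ m → sum (map (δ m ∘ (_% t)) B)) ([m+n]%n≡m%n y t)) ⟩
    1 + sum (map (congruent y) B)
      ≡⟨ cong suc (count-congruent B B<y D′ (flush-tail D flush) (flush-head flush)) ⟩
    1 + y / t
      ≡⟨ cong (λ z → 1 + z / t) (m+n∸n≡m y t) ⟨
    1 + (y + t ∸ t) / t
      ≡⟨ m/n≡1+[m∸n]/n (m≤n+m t y) ⟨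
    (y + t) / t ∎
    where open ≡-Reasoning

  -- The quotient `x / t` counts the congruent beads below `x`, so adding up `x % t + x / t * t`
  -- meets every congruent pair once, at its larger bead.
  sum-flush : ∀ {B} → Descending B → Flush B → sum B ≡ weight B
  sum-flush {[]}    _         _     = sym (*-zeroʳ t)
  sum-flush {x ∷ B} D@(B<x ∷ D′) flush = begin
    x + sum B
      ≡⟨ cong₂ _+_ (m≡m%n+[m/n]*n x t) (sum-flush D′ (flush-tail D flush)) ⟩
    x % t + x / t * t + (R + t * P)
      ≡⟨ regroup (x % t) (x / t) t R P ⟩
    x % t + R + t * (x / t + P)
      ≡⟨ cong (λ c → x % t + R + t * (c + P)) (count-congruent B B<x D′ (flush-tail D flush) (flush-head flush)) ⟨
    x % t + R + t * (sum (map (congruent x) B) + P) ∎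
    where
    open ≡-Reasoning
    R = sum (map (_% t) B)
    P = pairSum congruent B
    regroup : ∀ a q t R P → a + q * t + (R + t * P) ≡ a + R + t * (q + P)
    regroup = solve-∀

-- Size of the core in terms of beads

beads-below : ∀ r {f m} → Decreasing f → f 0 ≤ m → All (_< m + r) (beads r f)
beads-below zero    d f0≤m = []
beads-below (suc r) {f} {m} d f0≤m =
  ≤-trans (s≤s (+-monoˡ-≤ r f0≤m)) m+r<m+1+r ∷
  All.map (λ x< → <-trans x< m+r<m+1+r) (beads-below r (d ∘ suc) (≤-trans (d 0) f0≤m))
  where
  m+r<m+1+r : m + r < m + suc r
  m+r<m+1+r = ≤-reflexive (sym (+-suc m r))

beads-descending : ∀ r {f} → Decreasing f → Descending (beads r f)
beads-descending zero    d = []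
beads-descending (suc r) d = beads-below r (d ∘ suc) (d 0) ∷ beads-descending r (d ∘ suc)

downFrom-descending : ∀ n → Descending (downFrom n)
downFrom-descending zero    = []
downFrom-descending (suc n) = All.tabulate ∈-downFrom⁻ ∷ downFrom-descending n

-- The full interval is flush. This identity later trades the number of congruent pairs for the sum
-- of residues.
sum-downFrom : ∀ t .{{_ : NonZero t}} n → sum (downFrom n) ≡ weight t (downFrom n)
sum-downFrom t n = sum-flush t (downFrom-descending n)
  λ {z} m → ∈-downFrom⁺ (≤-<-trans (m≤m+n z t) (∈-downFrom⁻ m))

irreducible-flush : ∀ r t .{{_ : NonZero t}} {κs} → IsPartition κs → length κs ≤ r →
                    ¬ (∃[ μs ] RemoveRimHook t κs μs) → Flush t (beads r (row κs))
irreducible-flush r t {κs} P len irreducible {z} m with z ∈? beads r (row κs)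
... | yes z∈ = z∈
... | no  z∉ = contradiction (removable P len m z∉) irreducible

-- The core is flush, so its bead sum is its weight, which the removals leave unchanged. The right
-- side is the same whichever removals are chosen.
sum-core : ∀ r t .{{_ : NonZero t}} {λs κs} → IsPartition λs → length λs ≤ r → IsCoreOf t λs κs →
           sum κs + sum (downFrom r) ≡ weight t (beads r (row λs))
sum-core r t {λs} {κs} P len (removals , irreducible) = begin
  sum κs + sum (downFrom r)   ≡⟨ sum-beads r κs lenκ ⟨
  sum (beads r (row κs))      ≡⟨ sum-flush t (beads-descending r (row-decreasing (IsPartition.decreasing Pκ)))
                                            (irreducible-flush r t Pκ lenκ irreducible) ⟩
  weight t (beads r (row κs)) ≡⟨ w ⟨
  weight t (beads r (row λs)) ∎
  where
  open ≡-Reasoning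
  reduced : IsPartition κs × length κs ≤ r × weight t (beads r (row λs)) ≡ weight t (beads r (row κs))
  reduced = core-weight t P len removals
  Pκ = proj₁ reduced
  lenκ = proj₁ (proj₂ reduced)
  w = proj₂ (proj₂ reduced)

-- Sums over 𝒫_{r,s}

module _ {A : Set} where

  sum-map-+ : ∀ (f g : A → ℕ) xs → sum (map (λ x → f x + g x) xs) ≡ sum (map f xs) + sum (map g xs)
  sum-map-+ f g []       = refl
  sum-map-+ f g (x ∷ xs) rewrite sum-map-+ f g xs = +-interchange (f x) (g x) _ _

  sum-map-* : ∀ c (f : A → ℕ) xs → sum (map (λ x → c * f x) xs) ≡ c * sum (map f xs)
  sum-map-* c f []       = sym (*-zeroʳ c)
  sum-map-* c f (x ∷ xs) rewrite sum-map-* c f xs = sym (*-distribˡ-+ c (f x) (sum (map f xs)))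

  sum-map-const : ∀ c (xs : List A) → sum (map (λ _ → c) xs) ≡ length xs * c
  sum-map-const c []       = refl
  sum-map-const c (_ ∷ xs) = cong (c +_) (sum-map-const c xs)

𝒫-suc : ∀ r s → 𝒫 (suc r) (suc s) ≡ 𝒫 (suc r) s ++ map (suc s ∷_) (𝒫 r (suc s))
𝒫-suc r s = cong ([] ∷_) (begin
  concat (map block (upTo (suc s)))                         ≡⟨ cong (concat ∘ map block) (upTo-∷ʳ s) ⟨
  concat (map block (upTo s ∷ʳ s))                          ≡⟨ cong concat (map-++ block (upTo s) _) ⟩
  concat (map block (upTo s) ∷ʳ block s)                    ≡⟨ concat-++ (map block (upTo s)) _ ⟨
  concat (map block (upTo s)) ++ (block s ++ []) ≡⟨ cong (concat (map block (upTo s)) ++_) (++-identityʳ (block s)) ⟩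
  concat (map block (upTo s)) ++ block s          ∎)
  where
  open ≡-Reasoning
  block : ℕ → List (List ℕ)
  block k = map (suc k ∷_) (𝒫 r (suc k))

total : ℕ → ℕ → (List ℕ → ℕ) → ℕ
total r s F = sum (map (λ λs → F (beads r (row λs))) (𝒫 r s))

total-[] : ∀ r F → total r 0 F ≡ F (downFrom r)
total-[] zero    F = +-identityʳ (F [])
total-[] (suc r) F = trans (+-identityʳ _) (cong F (beads-[] (suc r)))

-- Pascal's rule: the two terms collect the bead sets without and with the top position `suc s + r`.
total-suc : ∀ r s F → total (suc r) (suc s) F ≡ total (suc r) s F + total r (suc s) (λ B → F (suc s + r ∷ B))
total-suc r s F = begin
  sum (map G (𝒫 (suc r) (suc s)))                        ≡⟨ cong (sum ∘ map G) (𝒫-suc r s) ⟩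
  sum (map G (𝒫 (suc r) s ++ map (suc s ∷_) (𝒫 r (suc s)))) ≡⟨ cong sum (map-++ G (𝒫 (suc r) s) _) ⟩
  sum (map G (𝒫 (suc r) s) ++ map G (map (suc s ∷_) (𝒫 r (suc s)))) ≡⟨ sum-++ (map G (𝒫 (suc r) s)) _ ⟩
  total (suc r) s F + sum (map G (map (suc s ∷_) (𝒫 r (suc s)))) ≡⟨ cong (λ xs → total (suc r) s F + sum xs) (map-∘ (𝒫 r (suc s))) ⟨
  total (suc r) s F + total r (suc s) (λ B → F (suc s + r ∷ B)) ∎
  where
  open ≡-Reasoning
  G : List ℕ → ℕ
  G λs = F (beads (suc r) (row λs))

size : ℕ → ℕ → ℕ
size r s = length (𝒫 r s)

size-suc : ∀ r s → size (suc r) (suc s) ≡ size (suc r) s + size r (suc s)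
size-suc r s = begin
  size (suc r) (suc s)                                    ≡⟨ ones (suc r) (suc s) ⟨
  total (suc r) (suc s) (λ _ → 1)                         ≡⟨ total-suc r s (λ _ → 1) ⟩
  total (suc r) s (λ _ → 1) + total r (suc s) (λ _ → 1)   ≡⟨ cong₂ _+_ (ones (suc r) s) (ones r (suc s)) ⟩
  size (suc r) s + size r (suc s)                         ∎
  where
  open ≡-Reasoning
  ones : ∀ r s → total r s (λ _ → 1) ≡ size r s
  ones r s = trans (sum-map-const 1 (𝒫 r s)) (*-identityʳ (size r s))

-- The numbers of bead sets containing one (`size₁`) or two (`size₂`) prescribed
-- positions, i.e. the binomials C(r+s−1 , r−1) and C(r+s−2 , r−2).
size₁ : ℕ → ℕ → ℕ
size₁ zero    s = 0
size₁ (suc r) s = size r s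

size₂ : ℕ → ℕ → ℕ
size₂ zero    s = 0
size₂ (suc r) s = size₁ r s

size-zero : ∀ r → size r 0 ≡ 1
size-zero zero    = refl
size-zero (suc r) = refl

size₁-suc : ∀ r s → size₁ (suc r) (suc s) ≡ size₁ (suc r) s + size₁ r (suc s)
size₁-suc zero    s = refl
size₁-suc (suc r) s = size-suc r s

size₂-suc : ∀ r s → size₂ (suc r) (suc s) ≡ size₂ (suc r) s + size₂ r (suc s)
size₂-suc zero    s = refl
size₂-suc (suc r) s = size₁-suc r s

-- Each position lies in `size₁ r s` bead sets. The induction peels off the top position, which only
-- the second term of Pascal's rule contains.
total-beads : ∀ a r s → total r s (λ B → sum (map a B)) ≡ size₁ r s * sum (map a (downFrom (r + s)))
total-beads a zero    s = refl
total-beads a (suc r) zero =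
  -- For `s = 0` the full interval is the only bead set, and `size r 0` is 1.
  trans (total-[] (suc r) (λ B → sum (map a B)))
        (trans (cong (λ n → sum (map a (downFrom n))) (sym (+-identityʳ (suc r))))
               (sym (trans (cong (_* S) (size-zero r)) (*-identityˡ S))))
  where
  S : ℕ
  S = sum (map a (downFrom (suc r + 0)))
total-beads a (suc r) (suc s) = begin
  total (suc r) (suc s) (λ B → sum (map a B))
    ≡⟨ total-suc r s (λ B → sum (map a B)) ⟩
  total (suc r) s (λ B → sum (map a B)) + total r (suc s) (λ B → a (suc s + r) + sum (map a B))
    ≡⟨ cong₂ _+_ (total-beads a (suc r) s) (sum-map-+ _ _ (𝒫 r (suc s))) ⟩
  size₁ (suc r) s * S + (total r (suc s) (λ B → a (suc s + r)) + total r (suc s) (λ B → sum (map a B)))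
    ≡⟨ cong (size₁ (suc r) s * S +_) (cong₂ _+_ (sum-map-const _ (𝒫 r (suc s))) (total-beads a r (suc s))) ⟩
  size₁ (suc r) s * S + (size r (suc s) * a (suc s + r) + size₁ r (suc s) * sum (map a (downFrom (r + suc s))))
    ≡⟨ cong₂ (λ m n → size₁ (suc r) s * S + (size r (suc s) * a m + size₁ r (suc s) * sum (map a (downFrom n)))) (cong suc (+-comm s r)) (+-suc r s) ⟩
  size₁ (suc r) s * S + (size r (suc s) * a n + size₁ r (suc s) * S)
    ≡⟨ collect (size₁ (suc r) s) S _ (size₁ r (suc s)) ⟩
  size r (suc s) * a n + (size₁ (suc r) s + size₁ r (suc s)) * S
    ≡⟨ cong (λ m → size r (suc s) * a n + m * S) (size₁-suc r s) ⟨
  size r (suc s) * a n + size r (suc s) * S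
    ≡⟨ *-distribˡ-+ (size r (suc s)) (a n) S ⟨
  size r (suc s) * (a n + S)
    ≡⟨ cong (λ m → size r (suc s) * sum (map a (downFrom (suc m)))) (+-suc r s) ⟨
  size₁ (suc r) (suc s) * sum (map a (downFrom (suc r + suc s))) ∎
  where
  open ≡-Reasoning
  n = suc (r + s)
  S = sum (map a (downFrom n))
  collect : ∀ k S c l → k * S + (c + l * S) ≡ c + (k + l) * S
  collect = solve-∀

-- As for single positions; the pairs containing the top bead reduce to `total-beads` for the
-- function `b (suc s + r)`.
total-pairs : ∀ b r s → total r s (pairSum b) ≡ size₂ r s * pairSum b (downFrom (r + s))
total-pairs b zero          s = refl
total-pairs b (suc zero)    zero = refl
total-pairs b (suc (suc r)) zero =
  trans (total-[] (suc (suc r)) (pairSum b))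
        (trans (cong (λ n → pairSum b (downFrom n)) (sym (+-identityʳ (suc (suc r)))))
               (sym (trans (cong (_* S) (size-zero r)) (*-identityˡ S))))
  where
  S : ℕ
  S = pairSum b (downFrom (suc (suc r) + 0))
total-pairs b (suc r) (suc s) = begin
  total (suc r) (suc s) (pairSum b)
    ≡⟨ total-suc r s (pairSum b) ⟩
  total (suc r) s (pairSum b) + total r (suc s) (λ B → sum (map (b (suc s + r)) B) + pairSum b B)
    ≡⟨ cong₂ _+_ (total-pairs b (suc r) s) (sum-map-+ _ _ (𝒫 r (suc s))) ⟩
  size₂ (suc r) s * S + (total r (suc s) (λ B → sum (map (b (suc s + r)) B)) + total r (suc s) (pairSum b))
    ≡⟨ cong (size₂ (suc r) s * S +_) (cong₂ _+_ (total-beads (b (suc s + r)) r (suc s)) (total-pairs b r (suc s))) ⟩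
  size₂ (suc r) s * S + (size₁ r (suc s) * sum (map (b (suc s + r)) (downFrom (r + suc s))) + size₂ r (suc s) * pairSum b (downFrom (r + suc s)))
    ≡⟨ cong₂ (λ m n → size₂ (suc r) s * S + (size₁ r (suc s) * sum (map (b m) (downFrom n)) + size₂ r (suc s) * pairSum b (downFrom n))) (cong suc (+-comm s r)) (+-suc r s) ⟩
  size₂ (suc r) s * S + (size₁ r (suc s) * R + size₂ r (suc s) * S)
    ≡⟨ collect (size₂ (suc r) s) S _ (size₂ r (suc s)) ⟩
  size₁ r (suc s) * R + (size₂ (suc r) s + size₂ r (suc s)) * S
    ≡⟨ cong (λ m → size₁ r (suc s) * R + m * S) (size₂-suc r s) ⟨
  size₁ r (suc s) * R + size₁ r (suc s) * S
    ≡⟨ *-distribˡ-+ (size₁ r (suc s)) R S ⟨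
  size₁ r (suc s) * (R + S)
    ≡⟨ cong (λ m → size₁ r (suc s) * pairSum b (downFrom (suc m))) (+-suc r s) ⟨
  size₂ (suc r) (suc s) * pairSum b (downFrom (suc r + suc s)) ∎
  where
  open ≡-Reasoning
  n = suc (r + s)
  S = pairSum b (downFrom n)
  R = sum (map (b n) (downFrom n))
  collect : ∀ k S c l → k * S + (c + l * S) ≡ c + (k + l) * S
  collect = solve-∀

length-beads : ∀ r f → length (beads r f) ≡ r
length-beads zero    f = refl
length-beads (suc r) f = cong suc (length-beads r (f ∘ suc))

-- Both sides count the pairs of a bead set and one of its beads.
size₁-absorb : ∀ r s → size₁ r s * (r + s) ≡ size r s * r
size₁-absorb r s = begin
  size₁ r s * (r + s)                                ≡⟨ cong (size₁ r s *_) (trans (count (downFrom (r + s))) (length-downFrom (r + s))) ⟨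
  size₁ r s * sum (map (λ _ → 1) (downFrom (r + s))) ≡⟨ total-beads (λ _ → 1) r s ⟨
  total r s (λ B → sum (map (λ _ → 1) B))            ≡⟨ cong sum (map-cong (λ λs → trans (count (beads r (row λs))) (length-beads r (row λs))) (𝒫 r s)) ⟩
  total r s (λ _ → r)                                ≡⟨ sum-map-const r (𝒫 r s) ⟩
  size r s * r                                       ∎
  where
  open ≡-Reasoning
  count : ∀ xs → sum (map (λ _ → 1) xs) ≡ length xs
  count xs = trans (sum-map-const 1 xs) (*-identityʳ (length xs))

-- Arithmetic of the expectation

suc-C-2 : ∀ m → suc m C 2 ≡ m + m C 2
suc-C-2 m = trans (sym (nCk+nC[k+1]≡[n+1]C[k+1] m 1)) (cong (_+ m C 2) (nC1≡n m))

residues : (t : ℕ) .{{_ : NonZero t}} → ℕ → ℕ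
residues t n = sum (map (_% t) (downFrom n))

-- A full period contributes 0 + ... + (t - 1). The bound is `m ≤ t` rather than `m < t` so that the
-- case `m = 0` can reopen one of the `q` periods as `m = t`.
residues-+* : ∀ t .{{_ : NonZero t}} q m → m ≤ t → residues t (m + q * t) ≡ m C 2 + q * (t C 2)
residues-+* t zero    zero    _   = refl
residues-+* t (suc q) zero    _   = residues-+* t q t ≤-refl
residues-+* t q       (suc m) m<t = begin
  (m + q * t) % t + residues t (m + q * t) ≡⟨ cong₂ _+_ (trans ([m+kn]%n≡m%n m q t) (m<n⇒m%n≡m m<t)) (residues-+* t q m (<⇒≤ m<t)) ⟩
  m + (m C 2 + q * (t C 2))                ≡⟨ +-assoc m (m C 2) _ ⟨
  m + m C 2 + q * (t C 2)                  ≡⟨ cong (_+ q * (t C 2)) (suc-C-2 m) ⟨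
  suc m C 2 + q * (t C 2)                  ∎
  where open ≡-Reasoning

residues-closed : ∀ t .{{_ : NonZero t}} n → residues t n ≡ (n % t) C 2 + n / t * (t C 2)
residues-closed t n = trans (cong (residues t) (m≡m%n+[m/n]*n n t)) (residues-+* t (n / t) (n % t) (m%n≤n n t))

double-sum-downFrom : ∀ n → 2 * sum (downFrom (suc n)) ≡ suc n * n
double-sum-downFrom zero    = refl
double-sum-downFrom (suc n) = begin
  2 * (suc n + sum (downFrom (suc n)))     ≡⟨ *-distribˡ-+ 2 (suc n) _ ⟩
  2 * suc n + 2 * sum (downFrom (suc n))   ≡⟨ cong (2 * suc n +_) (double-sum-downFrom n) ⟩
  2 * suc n + suc n * n                    ≡⟨ factor n ⟩
  suc (suc n) * suc n                      ∎
  where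
  open ≡-Reasoning
  factor : ∀ n → 2 * suc n + suc n * n ≡ suc (suc n) * suc n
  factor = solve-∀

sum-cores : ∀ r s t .{{_ : NonZero t}} →
  sum (map (λ λs → sum (core t λs)) (𝒫 r s)) + size r s * sum (downFrom r)
  ≡ size₁ r s * residues t (r + s) + t * (size₂ r s * pairSum (congruent t) (downFrom (r + s)))
sum-cores r s t = begin
  sum (map (λ λs → sum (core t λs)) (𝒫 r s)) + size r s * sum (downFrom r)
    ≡⟨ cong (S +_) (sum-map-const (sum (downFrom r)) (𝒫 r s)) ⟨
  sum (map (λ λs → sum (core t λs)) (𝒫 r s)) + sum (map (λ _ → sum (downFrom r)) (𝒫 r s))
    ≡⟨ sum-map-+ _ _ (𝒫 r s) ⟨
  sum (map (λ λs → sum (core t λs) + sum (downFrom r)) (𝒫 r s))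
    ≡⟨ cong sum (map-cong-local (All.tabulate λ {λs} λs∈ →
         let inRectangle P len _ = Equivalence.to (∈𝒫⇔ r s) λs∈ in sum-core r t P len (core-isCore t λs))) ⟩
  total r s (weight t)
    ≡⟨ sum-map-+ _ _ (𝒫 r s) ⟩
  total r s (λ B → sum (map (_% t) B)) + total r s (λ B → t * pairSum (congruent t) B)
    ≡⟨ cong₂ _+_ (total-beads (_% t) r s) (trans (sum-map-* t _ (𝒫 r s)) (cong (t *_) (total-pairs (congruent t) r s))) ⟩
  size₁ r s * residues t (r + s) + t * (size₂ r s * pairSum (congruent t) (downFrom (r + s))) ∎
  where
  open ≡-Reasoning
  S : ℕ
  S = sum (map (λ λs → sum (core t λs)) (𝒫 r s))

sum-cores-closed : ∀ r s t .{{_ : NonZero r}} .{{_ : NonZero t}} →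
  sum (map (λ λs → sum (core t λs)) (𝒫 r s)) * ((r + s) * (r + s ∸ 1))
  ≡ r * s * residues t (r + s) * size r s
-- Doubled and padded on both sides, so that neither the division in C(r,2) nor a subtraction occurs.
sum-cores-closed (suc r) s t = *-cancelˡ-≡ _ _ 2 (+-cancelʳ-≡ (N * (suc r * r) * (n * m) + 2 * (N * suc r * r * A)) _ _ (begin
  2 * (S * (n * m)) + (N * (suc r * r) * (n * m) + 2 * (N * suc r * r * A))
    ≡⟨ cong (λ k → 2 * (S * (n * m)) + (N * k * (n * m) + 2 * (N * suc r * r * A))) (double-sum-downFrom r) ⟨
  2 * (S * (n * m)) + (N * (2 * K) * (n * m) + 2 * (N * suc r * r * A))
    ≡⟨ expand S N K n m (suc r) r A ⟩
  2 * ((S + N * K) * (n * m)) + 2 * (N * suc r * r * A)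
    ≡⟨ cong (λ k → 2 * (k * (n * m)) + 2 * (N * suc r * r * A)) (sum-cores (suc r) s t) ⟩
  2 * ((N₁ * A + t * (N₂ * P)) * (n * m)) + 2 * (N * suc r * r * A)
    ≡⟨ cong (_+ 2 * (N * suc r * r * A)) (distribute N₁ A t N₂ P n m) ⟩
  2 * (N₁ * n * m * A + N₂ * m * n * (t * P)) + 2 * (N * suc r * r * A)
    -- At `suc r`, absorption turns `N₁ * n` into `N * suc r`; at `r`, where `size₁ r s` is `N₂`, it
    -- turns `N₂ * m` into `N₁ * r`.
    ≡⟨ cong₂ (λ j k → 2 * (j * m * A + k * n * (t * P)) + 2 * (N * suc r * r * A)) (size₁-absorb (suc r) s) (size₁-absorb r s) ⟩
  2 * (N * suc r * m * A + N₁ * r * n * (t * P)) + 2 * (N * suc r * r * A)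
    ≡⟨ cong (λ k → 2 * (N * suc r * m * A + k) + 2 * (N * suc r * r * A)) (trans (reorder N₁ r n (t * P)) (cong (λ k → k * r * (t * P)) (size₁-absorb (suc r) s))) ⟩
  2 * (N * suc r * m * A + N * suc r * r * (t * P)) + 2 * (N * suc r * r * A)
    -- The padding completes `t * P` to `A + t * P`, the weight of the full interval, whose double
    -- is `n * m`.
    ≡⟨ merge N (suc r) m A r (t * P) ⟩
  2 * (N * suc r * m * A) + N * suc r * r * (2 * (A + t * P))
    ≡⟨ cong (λ k → 2 * (N * suc r * m * A) + N * suc r * r * k) (trans (cong (2 *_) (sym (sum-downFrom t n))) (double-sum-downFrom m)) ⟩
  2 * (N * suc r * m * A) + N * suc r * r * (n * m)
    -- As `m = r + s`, splitting the padding off `N * suc r * m * A` leaves the factor `s`.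
    ≡⟨ split N r s A (n * m) ⟩
  2 * (suc r * s * A * N) + (N * (suc r * r) * (n * m) + 2 * (N * suc r * r * A)) ∎))
  where
  open ≡-Reasoning
  m = r + s
  n = suc m
  S = sum (map (λ λs → sum (core t λs)) (𝒫 (suc r) s))
  N = size (suc r) s
  N₁ = size₁ (suc r) s
  N₂ = size₂ (suc r) s
  K = sum (downFrom (suc r))
  A = residues t n
  P = pairSum (congruent t) (downFrom n)
  expand : ∀ S N K n m q r A → 2 * (S * (n * m)) + (N * (2 * K) * (n * m) + 2 * (N * q * r * A)) ≡ 2 * ((S + N * K) * (n * m)) + 2 * (N * q * r * A)
  expand = solve-∀
  distribute : ∀ N₁ A t N₂ P n m → 2 * ((N₁ * A + t * (N₂ * P)) * (n * m)) ≡ 2 * (N₁ * n * m * A + N₂ * m * n * (t * P))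
  distribute = solve-∀
  reorder : ∀ N₁ r n p → N₁ * r * n * p ≡ N₁ * n * r * p
  reorder = solve-∀
  merge : ∀ N q m A r p → 2 * (N * q * m * A + N * q * r * p) + 2 * (N * q * r * A) ≡ 2 * (N * q * m * A) + N * q * r * (2 * (A + p))
  merge = solve-∀
  split : ∀ N r s A l → 2 * (N * suc r * (r + s) * A) + N * suc r * r * l ≡ 2 * (suc r * s * A * N) + (N * (suc r * r) * l + 2 * (N * suc r * r * A))
  split = solve-∀

-- Opened late because +_ makes left sections of _+_ ambiguous.
open import Data.Integer using (+_) renaming (_*_ to _*ℤ_)
import Data.Integer.Properties as ℤ
open import Data.Rational using (toℚᵘ) renaming (_/_ to _/ℚ_; _*_ to _*ℚ_)
open import Data.Rational.Properties using (toℚᵘ-injective; toℚᵘ-fromℚᵘ; toℚᵘ-homo-*)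
open import Data.Rational.Unnormalised using (mkℚᵘ; *≡*) renaming (_*_ to _*ᵘ_)
import Data.Rational.Unnormalised.Properties as ℚᵘ

-- Passage to rational numbers

/ℚ-≡ : ∀ p q a d v .{{_ : NonZero q}} .{{_ : NonZero d}} → p * d ≡ a * v * q →
       + p /ℚ q ≡ (+ a /ℚ d) *ℚ (+ v /ℚ 1)
-- Rationals are stored in lowest terms, so the equation is checked on unnormalised fractions, where
-- it is a cross multiplication.
/ℚ-≡ p (suc q) a (suc d) v e = toℚᵘ-injective (begin
  toℚᵘ (+ p /ℚ suc q)                       ≈⟨ toℚᵘ-fromℚᵘ (mkℚᵘ (+ p) q) ⟩
  mkℚᵘ (+ p) q                              ≈⟨ *≡* cross ⟩
  mkℚᵘ (+ a) d *ᵘ mkℚᵘ (+ v) 0              ≈⟨ ℚᵘ.*-cong (toℚᵘ-fromℚᵘ (mkℚᵘ (+ a) d)) (toℚᵘ-fromℚᵘ (mkℚᵘ (+ v) 0)) ⟨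
  toℚᵘ (+ a /ℚ suc d) *ᵘ toℚᵘ (+ v /ℚ 1)    ≈⟨ toℚᵘ-homo-* (+ a /ℚ suc d) (+ v /ℚ 1) ⟨
  toℚᵘ ((+ a /ℚ suc d) *ℚ (+ v /ℚ 1))       ∎)
  where
  open ℚᵘ.≃-Reasoning
  cross : + p *ℤ (+ (suc d * 1)) ≡ (+ a *ℤ + v) *ℤ + suc q
  cross = trans (sym (ℤ.pos-* p (suc d * 1)))
    (trans (cong (λ k → + k) (trans (cong (λ k → p * k) (*-identityʳ (suc d))) e))
    (trans (ℤ.pos-* (a * v) (suc q)) (cong (_*ℤ + suc q) (ℤ.pos-* a v))))

proposition4p4 : (r s t : ℕ) .{{_ : NonZero r}} .{{_ : NonZero s}} .{{_ : NonTrivial t}} →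
    let instance t≢0 = nonTrivial⇒nonZero t
                 d≢0 = [r+s][r+s-1]≢0 r s
    in 𝔼 r s (λ λs → sum (core t λs))
       ≡ (+ (r * s) /ℚ ((r + s) * (r + s ∸ 1))) *ℚ (+ (((r + s) % t) C 2 + (r + s) / t * (t C 2)) /ℚ 1)
proposition4p4 r s t =
  let instance t≢0 = nonTrivial⇒nonZero t
               d≢0 = [r+s][r+s-1]≢0 r s
  in /ℚ-≡ (sum (map (λ λs → sum (core t λs)) (𝒫 r s))) (size r s) (r * s) ((r + s) * (r + s ∸ 1)) (((r + s) % t) C 2 + (r + s) / t * (t C 2)) {{𝒫-nonEmpty r s}}
       (trans (sum-cores-closed r s t) (cong (λ v → r * s * v * size r s) (residues-closed t (r + s))))
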